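{- Let $A$ be a commutative ring, $k\ge1$, $\vec s=(n_1,\dots,n_k)$ a tuple of positive integers, $X_\bullet=X_\bullet(\vec s;A)$ the diagonal simplicial tensor module, $p\ge1$ and $0\le j\le p$. The horn kernel $R_{p,j}$ is a free $A$-module with basis $\{E_m\}_{m\in M_{p,j}}$. Consequently, if $T_1,T_2\in X_p$ are two fillers of the same $(p,j)$-horn, their difference is supported on the missing indices: $\operatorname{supp}(T_1-T_2)\subseteq M_{p,j}$.
   Context: Notation: $[p]=\{0,\dots,p\}$. For a shape $\vec s=(n_1,\dots,n_k)$ put $n=\min(n_1,\dots,n_k)-1$, $M_a(p)=n_a-1-n+p$ (so $M_a(p)\ge p$) and $I_p=\prod_{a=1}^k[M_a(p)]$ for $p\ge 0$. Let $\delta_i^q:[q-1]\to[q]$ be the increasing injection missing $i$, and $\Delta_i^p=\prod_{a=1}^k\delta_i^{M_a(p)}:I_{p-1}\to I_p$ ($p\ge1$, $0\le i\le p$). The diagonal simplicial tensor module has $X_p=A^{I_p}$ (all functions $T:I_p\to A$) and faces $d_i^p(T)=T\circ\Delta_i^p$. For $m\in I_p$, $E_m\in X_p$ is the indicator function of $m$, and $\operatorname{supp}(T)=\{m\in I_p:T(m)\ne0\}$. Let $F_j=[p]\setminus\{j\}$. A $(p,j)$-horn is a tuple $(h_i)_{i\in F_j}$ of elements of $X_{p-1}$ with $d_i(h_\ell)=d_{\ell-1}(h_i)$ for all $i<\ell$ in $F_j$; a filler is $T\in X_p$ with $d_i(T)=h_i$ for all $i\in F_j$. The horn kernel is $R_{p,j}=\bigcap_{i\in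 F_j}\ker(d_i^p)\subseteq X_p$. An index $m\in I_p$ is missing from the $(p,j)$-horn if $m\notin\operatorname{im}(\Delta_i^p)$ for all $i\in F_j$; $M_{p,j}\subset I_p$ is the set of missing indices. -}

module Defs where

open import Level using (Level; _⊔_) renaming (suc to lsuc)
open import Algebra.Bundles using (CommutativeRing)
open import Algebra.Module.Bundles using (Module)
open import Algebra.Module.Structures.Biased using (module IsModuleFromLeft)
import Algebra.Properties.CommutativeMonoid.Sum as Sum
open import Data.Bool.Base using (if_then_else_)
open import Data.Fin.Base using (Fin; suc; inject₁; punchIn; _↑ˡ_; _<_)
import Data.Fin.Properties as Fin
open import Data.Nat.Base using (ℕ; zero; suc; _+_; _∸_; _⊓_)
open import Data.Product.Base using (∃; ∃-syntax; _,_; uncurry; <_,_>)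
open import Data.Refinement using (Refinement-syntax; _,_; value)
open import Data.Irrelevant using ([_])
open import Data.Unit.Base using (⊤)
open import Data.Vec.Base using (Vec; []; _∷_; foldr₁)
open import Data.Vec.Relation.Unary.All as All using (All; []; _∷_)
open import Function.Base using (_∘_)
open import Function.Definitions using (Injective)
open import Relation.Binary.Definitions using (DecidableEquality)
open import Relation.Binary.PropositionalEquality.Core using (_≡_; _≢_; refl; cong; cong₂)
open import Relation.Nullary using (¬_; does; yes; map′; _×-dec_)
open import Relation.Unary using (Pred; _∈_; ⋂)

module _ {r ℓr m ℓm : Level} {R : CommutativeRing r ℓr} (M : Module R m ℓm) where
  open CommutativeRing R using (Carrier; _≈_; 0#)
  open Module M
  open Sum +ᴹ-commutativeMonoid using (sum)

  record Submodule (p : Level) : Set (r ⊔ m ⊔ ℓm ⊔ lsuc p) where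
    field
      member    : Pred Carrierᴹ p
      resp-≈ᴹ   : ∀ {x y} → x ≈ᴹ y → x ∈ member → y ∈ member
      0ᴹ-closed : 0ᴹ ∈ member
      +ᴹ-closed : ∀ {x y} → x ∈ member → y ∈ member → x +ᴹ y ∈ member
      -ᴹ-closed : ∀ {x} → x ∈ member → -ᴹ x ∈ member
      *ₗ-closed : ∀ a {x} → x ∈ member → a *ₗ x ∈ member

    *ᵣ-closed : ∀ {x} → x ∈ member → ∀ a → x *ᵣ a ∈ member
    *ᵣ-closed x∈N a = resp-≈ᴹ (*ₗ-*ᵣ-coincident a _) (*ₗ-closed a x∈N)

    -- Elements are compared in M; the membership proof is ignored.
    toModule : Module R (m ⊔ p) ℓm
    toModule = record
      { Carrierᴹ = ∃ member
      ; _≈ᴹ_     = λ (x , _) (y , _) → x ≈ᴹ y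
      ; _+ᴹ_     = λ (x , x∈N) (y , y∈N) → x +ᴹ y , +ᴹ-closed x∈N y∈N
      ; _*ₗ_     = λ a (x , x∈N) → a *ₗ x , *ₗ-closed a x∈N
      ; _*ᵣ_     = λ (x , x∈N) a → x *ᵣ a , *ᵣ-closed x∈N a
      ; 0ᴹ       = 0ᴹ , 0ᴹ-closed
      ; -ᴹ_      = λ (x , x∈N) → -ᴹ x , -ᴹ-closed x∈N
      ; isModule = record
        { isBimodule = record
          { isBisemimodule = record
            { +ᴹ-isCommutativeMonoid = record
              { isMonoid = record
                { isSemigroup = record
                  { isMagma = record
                    { isEquivalence = record
                      { refl = ≈ᴹ-refl ; sym = ≈ᴹ-sym ; trans = ≈ᴹ-trans }
                    ; ∙-cong = +ᴹ-cong
                    }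
                  ; assoc = λ _ _ _ → +ᴹ-assoc _ _ _
                  }
                ; identity = (λ _ → +ᴹ-identityˡ _) , (λ _ → +ᴹ-identityʳ _)
                }
              ; comm = λ _ _ → +ᴹ-comm _ _
              }
            ; isPreleftSemimodule = record
              { *ₗ-cong      = *ₗ-cong
              ; *ₗ-zeroˡ     = λ _ → *ₗ-zeroˡ _
              ; *ₗ-distribʳ  = λ _ _ _ → *ₗ-distribʳ _ _ _
              ; *ₗ-identityˡ = λ _ → *ₗ-identityˡ _
              ; *ₗ-assoc     = λ _ _ _ → *ₗ-assoc _ _ _
              ; *ₗ-zeroʳ     = *ₗ-zeroʳ
              ; *ₗ-distribˡ  = λ _ _ _ → *ₗ-distribˡ _ _ _
              }
            ; isPrerightSemimodule = record
              { *ᵣ-cong      = *ᵣ-cong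
              ; *ᵣ-zeroʳ     = λ _ → *ᵣ-zeroʳ _
              ; *ᵣ-distribˡ  = λ _ _ _ → *ᵣ-distribˡ _ _ _
              ; *ᵣ-identityʳ = λ _ → *ᵣ-identityʳ _
              ; *ᵣ-assoc     = λ _ _ _ → *ᵣ-assoc _ _ _
              ; *ᵣ-zeroˡ     = *ᵣ-zeroˡ
              ; *ᵣ-distribʳ  = λ _ _ _ → *ᵣ-distribʳ _ _ _
              }
            ; *ₗ-*ᵣ-assoc = λ _ _ _ → *ₗ-*ᵣ-assoc _ _ _
            }
          ; -ᴹ‿cong    = -ᴹ‿cong
          ; -ᴹ‿inverse = (λ _ → -ᴹ‿inverseˡ _) , (λ _ → -ᴹ‿inverseʳ _)
          }
        ; *ₗ-*ᵣ-coincident = λ _ _ → *ₗ-*ᵣ-coincident _ _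
        }
      }

  linearCombination : ∀ {n} → (Fin n → Carrier) → (Fin n → Carrierᴹ) → Carrierᴹ
  linearCombination c v = sum (λ t → c t *ₗ v t)

  module _ {i : Level} {I : Set i} (b : I → Carrierᴹ) where

    LinearlyIndependent : Set (r ⊔ ℓr ⊔ ℓm ⊔ i)
    LinearlyIndependent =
      ∀ {n} (ι : Fin n → I) → Injective _≡_ _≡_ ι →
      ∀ (c : Fin n → Carrier) → linearCombination c (b ∘ ι) ≈ᴹ 0ᴹ → ∀ t → c t ≈ 0#

    Spanning : Set (r ⊔ m ⊔ ℓm ⊔ i)
    Spanning =
      ∀ x → ∃[ n ] ∃[ ι ] ∃[ c ] x ≈ᴹ linearCombination {n} c (b ∘ ι)

    record IsBasis : Set (r ⊔ ℓr ⊔ m ⊔ ℓm ⊔ i) where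
      field
        linearlyIndependent : LinearlyIndependent
        spanning            : Spanning

Shape : ℕ → Set
Shape k = Vec ℕ k

module Indices {k : ℕ} (s : Shape (suc k)) where

  dim : ℕ
  dim = foldr₁ _⊓_ s ∸ 1

  -- This is n_a - 1 - n + p for a = nₐ and n = dim; the subtractions never
  -- truncate when the entries of s are positive. With p in front,
  -- M nₐ (suc p) is suc (M nₐ p) by computation.
  M : ℕ → ℕ → ℕ
  M nₐ p = p + (nₐ ∸ 1 ∸ dim)

  -- The product over a of [M_a(p)], as heterogeneous tuples; [q] is Fin (suc q).
  I : ℕ → Set
  I p = All (λ nₐ → Fin (suc (M nₐ p))) s

  -- punchIn i is the increasing injection missing i.
  Δ : ∀ {p} → Fin (suc (suc p)) → I p → I (suc p)
  Δ i = All.map (punchIn (i ↑ˡ _))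

  _≟_ : ∀ {p} → DecidableEquality (I p)
  _≟_ = go
    where
    go : ∀ {n p} {v : Vec ℕ n} → DecidableEquality (All (λ nₐ → Fin (suc (M nₐ p))) v)
    go []       []       = yes refl
    go (x ∷ xs) (y ∷ ys) =
      map′ (uncurry (cong₂ _∷_)) < cong All.head , cong All.tail > (x Fin.≟ y ×-dec go xs ys)

  -- Refinements carry irrelevant proofs, so elements of F j, and likewise of
  -- MissingIndex j, are equal as soon as their values are.
  F : ∀ {p} → Fin (suc p) → Set
  F {p} j = [ i ∈ Fin (suc p) ∣ i ≢ j ]

  Missing : ∀ {p} → Fin (suc (suc p)) → Pred (I (suc p)) _
  Missing j m = ∀ (i : F j) → ¬ (∃[ x ] Δ (value i) x ≡ m)

  MissingIndex : ∀ {p} → Fin (suc (suc p)) → Set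
  MissingIndex {p} j = [ m ∈ I (suc p) ∣ m ∈ Missing j ]

module Tensors {c ℓ : Level} (A : CommutativeRing c ℓ) {k : ℕ} (s : Shape (suc k)) where
  open CommutativeRing A hiding (zero) renaming (_+_ to _+ᴬ_; refl to ≈-refl)
  open Indices s public

  X : ℕ → Module A c ℓ
  X p = record
    { Carrierᴹ = I p → Carrier
    ; _≈ᴹ_     = λ T U → ∀ m → T m ≈ U m
    ; _+ᴹ_     = λ T U m → T m +ᴬ U m
    ; _*ₗ_     = λ a T m → a * T m
    ; _*ᵣ_     = λ T a m → a * T m
    ; 0ᴹ       = λ _ → 0#
    ; -ᴹ_      = λ T m → - T m
    ; isModule = IsModuleFromLeft.isModule {commutativeRing = A} record
      { isLeftModule = record
        { isLeftSemimodule = record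
          { +ᴹ-isCommutativeMonoid = record
            { isMonoid = record
              { isSemigroup = record
                { isMagma = record
                  { isEquivalence = record
                    { refl  = λ _ → ≈-refl
                    ; sym   = λ e m → sym (e m)
                    ; trans = λ e f m → trans (e m) (f m)
                    }
                  ; ∙-cong = λ e f m → +-cong (e m) (f m)
                  }
                ; assoc = λ _ _ _ _ → +-assoc _ _ _
                }
              ; identity = (λ _ _ → +-identityˡ _) , (λ _ _ → +-identityʳ _)
              }
            ; comm = λ _ _ _ → +-comm _ _
            }
          ; isPreleftSemimodule = record
            { *ₗ-cong      = λ e f m → *-cong e (f m)
            ; *ₗ-zeroˡ     = λ _ _ → zeroˡ _
            ; *ₗ-distribʳ  = λ _ _ _ _ → distribʳ _ _ _
            ; *ₗ-identityˡ = λ _ _ → *-identityˡ _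
            ; *ₗ-assoc     = λ _ _ _ _ → *-assoc _ _ _
            ; *ₗ-zeroʳ     = λ _ _ → zeroʳ _
            ; *ₗ-distribˡ  = λ _ _ _ _ → distribˡ _ _ _
            }
          }
        ; -ᴹ‿cong    = λ e m → -‿cong (e m)
        ; -ᴹ‿inverse = (λ _ _ → -‿inverseˡ _) , (λ _ _ → -‿inverseʳ _)
        }
      }
    }

  module X (p : ℕ) = Module (X p)

  Tensor : ℕ → Set c
  Tensor p = X.Carrierᴹ p

  infixl 6 _-ᵀ_
  _-ᵀ_ : ∀ {p} → Tensor p → Tensor p → Tensor p
  _-ᵀ_ {p} T U = X._+ᴹ_ p T (X.-ᴹ_ p U)

  face : ∀ {p} → Fin (suc (suc p)) → Tensor (suc p) → Tensor p
  face i T = T ∘ Δ i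

  E : ∀ {p} → I p → Tensor p
  E m m₁ = if does (m ≟ m₁) then 1# else 0#

  supp : ∀ {p} → Tensor p → Pred (I p) ℓ
  supp T m = ¬ (T m ≈ 0#)

  -- Compatibility ranges over i < suc l, with i below the top index, which
  -- is automatic. For horns of 1-simplices there is no pair of such indices,
  -- nor are there faces of 0-simplices.
  Compatible : ∀ {p} (j : Fin (suc (suc p))) → (F j → Tensor p) → Set ℓ
  Compatible {zero}  j h = Level.Lift ℓ ⊤
  Compatible {suc p} j h =
    ∀ (i l : Fin (suc (suc p))) (i≢j : inject₁ i ≢ j) (l≢j : suc l ≢ j) → inject₁ i < suc l →
    X._≈ᴹ_ p (face i (h (suc l , [ l≢j ]))) (face l (h (inject₁ i , [ i≢j ])))

  record Horn (p : ℕ) (j : Fin (suc (suc p))) : Set (c ⊔ ℓ) where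
    field
      faces      : F j → Tensor p
      compatible : Compatible j faces

  IsFiller : ∀ {p j} → Horn p j → Pred (Tensor (suc p)) ℓ
  IsFiller {p} h T = ∀ i → X._≈ᴹ_ p (face (value i) T) (Horn.faces h i)

  Ker : ∀ {p q} → (Tensor p → Tensor q) → Pred (Tensor p) ℓ
  Ker {q = q} f T = X._≈ᴹ_ q (f T) (X.0ᴹ q)

  HornKernel : ∀ {p} → Fin (suc (suc p)) → Submodule (X (suc p)) ℓ
  HornKernel j = record
    { member    = ⋂ (F j) (λ i → Ker (face (value i)))
    ; resp-≈ᴹ   = λ e z i x → trans (sym (e _)) (z i x)
    ; 0ᴹ-closed = λ _ _ → ≈-refl
    ; +ᴹ-closed = λ z w i x → trans (+-cong (z i x) (w i x)) (+-identityˡ 0#)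
    ; -ᴹ-closed = λ z i x →
        trans (-‿cong (z i x)) (trans (sym (+-identityˡ (- 0#))) (-‿inverseʳ 0#))
    ; *ₗ-closed = λ a z i x → trans (*-congˡ (z i x)) (zeroʳ a)
    }

{-# OPTIONS --safe #-}
module Submission where

-- A missing index m lies in no image of Δ i, so every face d_i with i ≠ j kills
-- E m. Conversely an element of the kernel vanishes at Δ i x because its value
-- there is a value of its i-th face; since I (suc p) is finite, it is therefore
-- the sum of its entries at the missing indices.

open import Defs
open import Algebra.Bundles using (CommutativeMonoid; CommutativeRing)
import Algebra.Properties.CommutativeMonoid.Sum as Sum
open import Data.Empty using (⊥-elim-irr)
open import Data.Fin.Base using (Fin; zero; suc; punchIn)
open import Data.Fin.Properties using (any?; punchInᵢ≢i; *↔×)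
import Data.Fin.Properties as Fin
open import Data.Irrelevant using ([_])
open import Data.Nat.Base using (ℕ; zero; suc; NonZero)
open import Data.Product.Base using (Σ-syntax; ∃; ∃-syntax; _×_; _,_; proj₁)
open import Data.Product.Function.NonDependent.Propositional using (_×-↔_)
open import Data.Refinement using (value; value-injective; _,_)
open import Data.Vec.Base using (Vec; []; _∷_)
open import Data.Vec.Functional as Vector using (Vector)
open import Data.Vec.Relation.Unary.All using (All; []; _∷_; uncons)
open import Function.Base using (_∘_)
open import Function.Bundles using (_↔_; Injection; Inverse; mk↔ₛ′)
open import Function.Definitions using (Injective)
open import Function.Properties.Inverse using (↔-refl; ↔-trans; ↔⇒↣)
open import Level using (Level)
open import Relation.Binary.PropositionalEquality.Core using (_≡_; _≢_; refl; sym; subst)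
open import Relation.Nullary using (¬_; Dec; yes; no; map′; ¬?; _×-dec_)
open import Relation.Nullary.Decidable using (dec-true; dec-false)
open import Relation.Unary using (Pred; Decidable; _∈_; _⊆_)

private variable
  a p : Level
  B   : Set a
  n   : ℕ

Finite : Set a → Set a
Finite B = ∃[ n ] (Fin n ↔ B)

-- By induction on the vector: a nonempty tuple is its head paired with its tail, and `*↔×`
-- enumerates such pairs. The empty tuple contributes exactly one element.
All-finite : {P : Pred B p} → (∀ x → Finite (P x)) → (xs : Vec B n) → Finite (All P xs)
All-finite fin [] = 1 , mk↔ₛ′ (λ _ → []) (λ _ → zero) (λ { [] → refl }) (λ { zero → refl })
All-finite fin (x ∷ xs) with fin x | All-finite fin xs
... | _ , x↔ | _ , xs↔ = _ , ↔-trans *↔× (↔-trans (x↔ ×-↔ xs↔) cons)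
  where
  cons = mk↔ₛ′ (λ (y , ys) → y ∷ ys) uncons (λ { (_ ∷ _) → refl }) (λ _ → refl)

any-finite? : {P : Pred B p} → Finite B → Decidable P → Dec (∃ P)
any-finite? {P = P} (_ , e) P? =
  map′ (λ (t , Pt) → to t , Pt)
       (λ (x , Px) → from x , subst P (sym (strictlyInverseˡ x)) Px)
       (any? (P? ∘ to))
  where open Inverse e

module _ {c ℓ} (M : CommutativeMonoid c ℓ) where
  open CommutativeMonoid M renaming (trans to ≈-trans; refl to ≈-refl)
  open Sum M

  sum-zero : ∀ {n} (f : Vector Carrier n) → (∀ t → f t ≈ ε) → sum f ≈ ε
  sum-zero {n} f f≈ε = ≈-trans (sum-cong-≋ f≈ε) (sum-replicate-zero n)

  sum-single : ∀ {n} (f : Vector Carrier n) t → (∀ u → u ≢ t → f u ≈ ε) → sum f ≈ f t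
  sum-single {suc n} f t f≈ε =
    ≈-trans (sum-remove {i = t} f)
    (≈-trans (∙-congˡ (sum-zero _ (λ u → f≈ε (punchIn t u) (punchInᵢ≢i t u))))
             (identityʳ (f t)))

module _ {c ℓ} (A : CommutativeRing c ℓ) {k : ℕ} (s : Shape (suc k)) where
  open Tensors A s
  open CommutativeRing A
    using (Carrier; _≈_; _*_; 0#; 1#; +-commutativeMonoid; +-cong; +-congˡ; +-identityˡ;
           -‿cong; -‿inverseʳ; *-congˡ; *-congʳ; *-identityʳ; zeroˡ; zeroʳ)
    renaming (refl to ≈-refl; sym to ≈-sym; trans to ≈-trans)
  open Sum +-commutativeMonoid using (sum)

  I-finite : ∀ p → Finite (I p)
  I-finite p = All-finite (λ _ → _ , ↔-refl) s

  E-diagonal : ∀ {p} (m : I p) → E m m ≈ 1#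
  E-diagonal m rewrite dec-true (m ≟ m) refl = ≈-refl

  E-off-diagonal : ∀ {p} {m m′ : I p} → m ≢ m′ → E m m′ ≈ 0#
  E-off-diagonal {m = m} {m′} m≢m′ rewrite dec-false (m ≟ m′) m≢m′ = ≈-refl

  -- Injectivity makes `ι t` differ from every other index, so only the term at `t` survives. This
  -- extracts coefficients for independence and expands a tensor in indicators for spanning.
  sum-E : ∀ {p n} (ι : Fin n → I p) → Injective _≡_ _≡_ ι → ∀ (c : Fin n → Carrier) t →
          sum (λ u → c u * E (ι u) (ι t)) ≈ c t
  sum-E ι ι-inj c t =
    ≈-trans (sum-single +-commutativeMonoid _ t
               (λ u u≢t → ≈-trans (*-congˡ (E-off-diagonal (u≢t ∘ ι-inj))) (zeroʳ _)))
            (≈-trans (*-congˡ (E-diagonal (ι t))) (*-identityʳ _))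

  module _ {p : ℕ} (j : Fin (suc (suc p))) where
    open Submodule (HornKernel j) using (member; toModule)

    -- A positive complement to `Missing j`, decidable by finite search over `i` and `x`. The
    -- inequality is a relevant component here, unlike in `F j`.
    Covered : Pred (I (suc p)) _
    Covered m = ∃[ i ] i ≢ j × ∃[ x ] Δ i x ≡ m

    covered? : Decidable Covered
    covered? m = any? λ i → ¬? (i Fin.≟ j) ×-dec any-finite? (I-finite p) (λ x → Δ i x ≟ m)

    uncovered⇒missing : ∀ {m} → ¬ Covered m → m ∈ Missing j
    uncovered⇒missing {m} ¬cov (i , [ i≢j ]) (x , eq) =
      -- The irrelevant `i≢j` may be used here because it serves only to derive a contradiction.
      ¬cov (i , (λ i≡j → ⊥-elim-irr (i≢j i≡j)) , x , eq)

    kernel-vanishes : ∀ {T} → T ∈ member → ∀ {m} → Covered m → T m ≈ 0#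
    kernel-vanishes T∈R (i , i≢j , x , refl) = T∈R (i , [ i≢j ]) x

    E∈kernel : (m : MissingIndex j) → E (value m) ∈ member
    E∈kernel (m , [ m∈ ]) i x = E-off-diagonal λ m≡Δ → ⊥-elim-irr (m∈ i (x , sym m≡Δ))

    basis : MissingIndex j → ∃ member
    basis m = E (value m) , E∈kernel m

    combination : ∀ {n} → (Fin n → Carrier) → (Fin n → MissingIndex j) → Tensor (suc p)
    combination c ι = proj₁ (linearCombination toModule c (basis ∘ ι))

    -- The left side is summed in `toModule`, on tensors paired with membership proofs. Each
    -- addition there is entrywise on the tensors, so induction on the length turns it into a sum in
    -- `A`.
    combination-pointwise : ∀ {n} (c : Fin n → Carrier) (ι : Fin n → MissingIndex j) m →
                            combination c ι m ≈ sum (λ t → c t * E (value (ι t)) m)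
    combination-pointwise {zero}  c ι m = ≈-refl
    combination-pointwise {suc n} c ι m = +-congˡ (combination-pointwise (c ∘ suc) (ι ∘ suc) m)

    -- Terms at covered indices have coefficient zero and can be deleted. Each index that is kept
    -- has been decided to be uncovered, which supplies its proof of being missing.
    drop-covered : ∀ {n} (f : Fin n → I (suc p)) (c : Fin n → Carrier) →
                   (∀ t → Covered (f t) → c t ≈ 0#) →
                   ∃[ n′ ] ∃[ ι ] ∃[ c′ ] ∀ m →
                   sum (λ t → c t * E (f t) m) ≈ combination {n′} c′ ι m
    drop-covered {zero}  f c c≈0 = 0 , (λ ()) , (λ ()) , λ _ → ≈-refl
    drop-covered {suc n} f c c≈0
      with covered? (f zero) | drop-covered (f ∘ suc) (c ∘ suc) (c≈0 ∘ suc)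
    ... | yes cov | n′ , ι , c′ , eq = n′ , ι , c′ , λ m →
      ≈-trans (+-cong (≈-trans (*-congʳ (c≈0 zero cov)) (zeroˡ _)) (eq m)) (+-identityˡ _)
    ... | no ¬cov | n′ , ι , c′ , eq =
      suc n′ , (f zero , [ uncovered⇒missing ¬cov ]) Vector.∷ ι , c zero Vector.∷ c′ ,
      λ m → +-congˡ (eq m)

    basis-isBasis : IsBasis toModule basis
    basis-isBasis = record { linearlyIndependent = independent ; spanning = spans }
      where
      independent : LinearlyIndependent toModule basis
      independent ι ι-inj c comb≈0 t =
        -- Evaluating the vanishing combination at the index `ι t` isolates `c t`. The underlying
        -- indices stay distinct because refinements with equal values are equal.
        ≈-trans (≈-sym (sum-E (value ∘ ι) (ι-inj ∘ value-injective) c t))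
        (≈-trans (≈-sym (combination-pointwise c ι (value (ι t)))) (comb≈0 (value (ι t))))

      spans : Spanning toModule basis
      spans (T , T∈R) with I-finite (suc p)
      -- Start from the expansion of `T` over all indices, with its own entries as coefficients;
      -- those at covered indices vanish.
      ... | _ , e with drop-covered to (T ∘ to) (λ _ → kernel-vanishes {T = T} T∈R)
        where open Inverse e
      ... | n′ , ι , c′ , eq = n′ , ι , c′ , λ m → ≈-trans (≈-sym (expand m)) (eq m)
        where
        open Inverse e
        expand : ∀ m → sum (λ t → T (to t) * E (to t) m) ≈ T m
        -- `sum-E` evaluates only at enumerated points, so `m` is treated as `to (from m)`.
        expand m = subst (λ m′ → sum (λ t → T (to t) * E (to t) m′) ≈ T m′)
                         (strictlyInverseˡ m) (sum-E to (Injection.injective (↔⇒↣ e)) (T ∘ to) (from m))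

    -- At an index `Δ i x` with `i` in `F j`, both fillers take the value of the horn's face `i` at
    -- `x`, so their difference vanishes there.
    fillers-differ-on-missing : (h : Horn p j) {T₁ T₂ : Tensor (suc p)} →
      T₁ ∈ IsFiller h → T₂ ∈ IsFiller h → supp (T₁ -ᵀ T₂) ⊆ Missing j
    fillers-differ-on-missing h fills₁ fills₂ m∈supp i (x , refl) =
      m∈supp (≈-trans (+-cong (fills₁ i x) (-‿cong (fills₂ i x))) (-‿inverseʳ _))

theorem3p7 :
    ∀ {c ℓ} (A : CommutativeRing c ℓ) (k : ℕ) (s : Shape (suc k)) → All NonZero s →
    ∀ (p : ℕ) (j : Fin (suc (suc p))) →
    let open Tensors A s
        R = HornKernel j
    in
    (Σ[ E∈R ∈ (∀ (m : MissingIndex j) → E (value m) ∈ Submodule.member R) ]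
       IsBasis (Submodule.toModule R) (λ (m : MissingIndex j) → E (value m) , E∈R m))
    × (∀ (h : Horn p j) (T₁ T₂ : Tensor (suc p)) → T₁ ∈ IsFiller h → T₂ ∈ IsFiller h →
       supp (T₁ -ᵀ T₂) ⊆ Missing j)
theorem3p7 A k s _ p j =
  (E∈kernel A s j , basis-isBasis A s j) ,
  λ h T₁ T₂ → fillers-differ-on-missing A s j h
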